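{- Let $G$ be a finite simple graph with $\mathrm{mad}(G)<3$. Then $\chi'_a(G)\leq \Delta(G)+1$.
   Context: A proper edge coloring of a graph is acyclic if there is no bichromatic cycle, i.e. the union of any two color classes induces a forest. The acyclic chromatic index $\chi'_a(G)$ is the least $k$ such that $G$ has an acyclic proper edge coloring with $k$ colors. $\Delta(G)$ is the maximum degree. The maximum average degree is $\mathrm{mad}(G)=\max_{H\subseteq G}\frac{2|E(H)|}{|V(H)|}$, the maximum over all (nonempty) subgraphs $H$. -}

module Defs where

open import Data.Nat using (ℕ; zero; suc; _+_; _*_; _<_; _≤_; _⊔_)
open import Data.Fin using (Fin; zero; suc; toℕ; inject₁; fromℕ)
open import Data.Bool using (Bool; true; false; if_then_else_; T; _∧_)
open import Data.List using (List; map; foldr; allFin)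
open import Data.Nat.ListAction using (sum)
open import Data.Product using (Σ; _×_; ∃)
open import Data.Sum using (_⊎_)
open import Relation.Binary.PropositionalEquality using (_≡_)
open import Function.Definitions using (Injective)
open import Relation.Nullary.Decidable using (⌊_⌋)
open import Data.Nat using (_<?_)
open import Relation.Nullary using (¬_)

record Graph (n : ℕ) : Set where
  field
    adj    : Fin n → Fin n → Bool
    sym    : ∀ u v → adj u v ≡ adj v u
    irrefl : ∀ v → adj v v ≡ false
open Graph public

count : ∀ {n} → (Fin n → Bool) → ℕ
count {n} p = sum (map (λ i → if p i then 1 else 0) (allFin n))

degree : ∀ {n} → Graph n → Fin n → ℕ
degree G v = count (adj G v)

-- Maximum degree Δ(G) (0 for the empty graph).
maxDegree : ∀ {n} → Graph n → ℕ
maxDegree {n} G = foldr _⊔_ 0 (map (degree G) (allFin n))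

record Subgraph {n : ℕ} (G : Graph n) : Set where
  field
    vset    : Fin n → Bool
    eset    : Fin n → Fin n → Bool
    esym    : ∀ u v → eset u v ≡ eset v u
    e⊆adj   : ∀ u v → T (eset u v) → T (adj G u v)
    e⊆vset  : ∀ u v → T (eset u v) → T (vset u ∧ vset v)
open Subgraph public

numVertices : ∀ {n} {G : Graph n} → Subgraph G → ℕ
numVertices H = count (vset H)

sumFin : ∀ {n} → (Fin n → ℕ) → ℕ
sumFin {n} f = sum (map f (allFin n))

-- |E(H)|: number of unordered pairs {u,v} (counted once, with u < v) in eset.
numEdges : ∀ {n} {G : Graph n} → Subgraph G → ℕ
numEdges H = sumFin (λ u → count (λ v → ⌊ toℕ u <? toℕ v ⌋ ∧ eset H u v))

-- mad(G) < 3  :⇔  for every nonempty subgraph H, 2|E(H)|/|V(H)| < 3,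
-- i.e. 2|E(H)| < 3|V(H)|.
madLessThan3 : ∀ {n} → Graph n → Set
madLessThan3 G = ∀ (H : Subgraph G) → 0 < numVertices H →
                 2 * numEdges H < 3 * numVertices H

-- An edge colouring with k colours: a colour for each (ordered) pair,
-- required to be symmetric on the edges of G (values on non-edges are
-- irrelevant).
record EdgeColouring {n : ℕ} (G : Graph n) (k : ℕ) : Set where
  field
    col    : Fin n → Fin n → Fin k
    colSym : ∀ u v → T (adj G u v) → col u v ≡ col v u
open EdgeColouring public

Proper : ∀ {n k} {G : Graph n} → EdgeColouring G k → Set
Proper {G = G} c = ∀ u v w → T (adj G u v) → T (adj G u w) → ¬ (v ≡ w) →
                   ¬ (col c u v ≡ col c u w)

-- A cycle of G of length m+1 ≥ 3: distinct vertices f 0, …, f m with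
-- f i ~ f (i+1) for i < m and f m ~ f 0.
record Cycle {n : ℕ} (G : Graph n) : Set where
  field
    len    : ℕ
    len≥2  : 2 ≤ len
    vtx    : Fin (suc len) → Fin n
    inj    : Injective _≡_ _≡_ vtx
    step   : ∀ (i : Fin len) → T (adj G (vtx (inject₁ i)) (vtx (suc i)))
    close  : T (adj G (vtx (fromℕ len)) (vtx zero))
open Cycle public

Bichromatic : ∀ {n k} {G : Graph n} → EdgeColouring G k → Cycle G → Set
Bichromatic {k = k} c C = ∃ λ (a : Fin k) → ∃ λ (b : Fin k) →
  (∀ (i : Fin (len C)) →
     let x = col c (vtx C (inject₁ i)) (vtx C (suc i)) in (x ≡ a) ⊎ (x ≡ b))
  × (let x = col c (vtx C (fromℕ (len C))) (vtx C zero) in (x ≡ a) ⊎ (x ≡ b))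

Acyclic : ∀ {n k} {G : Graph n} → EdgeColouring G k → Set
Acyclic {G = G} c = Proper c × (∀ (C : Cycle G) → ¬ Bichromatic c C)

AcyclicChromaticIndex≤ : ∀ {n} → Graph n → ℕ → Set
AcyclicChromaticIndex≤ G k = Σ (EdgeColouring G k) Acyclic

{-# OPTIONS --safe #-}

-- Let D bound the degrees and use D + 1 colours, by induction on the number of edges; d(v) is
-- the degree of v and t(v) its number of neighbours of degree 2. A vertex of degree 1 can be
-- coloured last. For a vertex x of degree 2 with neighbours y, z, colour G − x. If no extension
-- to xy, xz is acyclic, then for all colours a missing at y and c ≠ a missing at z there is an
-- (a, c)-alternating path from z to y. Hence every colour c missing at z occurs at y, and the
-- c-neighbour of y sees c and every colour missing at y; counting colours gives
-- D + 2 + t(y) ≤ d(y) + d(z), and likewise with y and z exchanged.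
--
-- If D ≤ 3, then y has just two neighbours y₁, y₂ in G − x; exchanging the colours of yy₁ and yy₂
-- stays acyclic, and the path from z now ends in y₁ instead of reaching y, so x can be coloured.
-- If D ≥ 4, let every vertex of degree at least 4 give charge to its neighbours of degree 2,
-- namely 2 if there is only one of them and 1 each otherwise. Starting from 2 d(v), every
-- non-isolated vertex ends with at least 6, contradicting mad(G) < 3.

module Submission where

open import Defs renaming (sym to adj-sym)
open import Data.Bool using (Bool; true; false; T; _∧_; if_then_else_)
open import Data.Bool.Properties using (T?; T-∧)
open import Data.Empty using (⊥-elim)
open import Data.Fin using (Fin; zero; suc; inject₁; fromℕ; fromℕ<; toℕ)
open import Data.Fin.Induction using (>-weakInduction)
open import Data.Fin.Properties using (_≟_; any?; injective⇒≤; toℕ-fromℕ<; toℕ-injective; suc-injective; inject₁-injective; fromℕ≢inject₁; 0≢1+n)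
open import Data.List.Base using (foldr)
open import Data.List.Membership.Propositional using (_∈_)
open import Data.List.Membership.Propositional.Properties using (∈-map⁺; ∈-allFin)
open import Data.List.Properties using (map-tabulate)
open import Data.List.Relation.Unary.Any using (here; there)
open import Data.Nat renaming (_≟_ to _≟ℕ_)
open import Data.Nat.Induction using (<-wellFounded)
open import Data.Nat.ListAction using (sum)
open import Data.Nat.Properties hiding (_≟_; suc-injective; 0≢1+n)
open import Data.Nat.Tactic.RingSolver using (solve-∀)
open import Data.Product using (∃; _×_; _,_; proj₁; proj₂)
open import Data.Sum using (_⊎_; inj₁; inj₂; swap) renaming (map to map⊎)
open import Data.Unit using (tt)
open import Function using (_∘_; id)
open import Function.Bundles using (Equivalence)
open import Function.Definitions using (Injective)
open import Induction.WellFounded using (Acc; acc)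
open import Relation.Binary.Definitions using (tri<; tri≈; tri>)
open import Relation.Binary.PropositionalEquality hiding ([_])
open import Relation.Nullary
open import Relation.Nullary.Decidable using (⌊_⌋; fromWitness)

-- Sums and counting over Fin n

does⁺ : ∀ {p} {P : Set p} (P? : Dec P) → P → T (does P?)
does⁺ (yes _) _ = tt
does⁺ (no ¬p) p = ¬p p

does⁻ : ∀ {p} {P : Set p} (P? : Dec P) → T (does P?) → P
does⁻ (yes p) _ = p

T-∧⁺ : ∀ {a b} → T a → T b → T (a ∧ b)
T-∧⁺ a b = Equivalence.from T-∧ (a , b)

T-∧⁻ : ∀ {a b} → T (a ∧ b) → T a × T b
T-∧⁻ = Equivalence.to T-∧

[_] : Bool → ℕ
[ b ] = if b then 1 else 0

[]-mono : ∀ {a b} → (T a → T b) → [ a ] ≤ [ b ]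
[]-mono {false}        _ = z≤n
[]-mono {true} {true}  _ = ≤-refl
[]-mono {true} {false} h with () ← h tt

sumFin-suc : ∀ {n} (f : Fin (suc n) → ℕ) → sumFin f ≡ f zero + sumFin (f ∘ suc)
sumFin-suc {n} f = cong (f zero +_) (cong sum (trans (map-tabulate suc f) (sym (map-tabulate id (f ∘ suc)))))

sumFin-mono : ∀ {n} {f g : Fin n → ℕ} → (∀ i → f i ≤ g i) → sumFin f ≤ sumFin g
sumFin-mono {zero}          _ = z≤n
sumFin-mono {suc n} {f} {g} h rewrite sumFin-suc f | sumFin-suc g =
  +-mono-≤ (h zero) (sumFin-mono (h ∘ suc))

sumFin-mono-< : ∀ {n} {f g : Fin n → ℕ} → (∀ i → f i ≤ g i) → ∀ i → f i < g i → sumFin f < sumFin g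
sumFin-mono-< {suc n} {f} {g} h zero    l rewrite sumFin-suc f | sumFin-suc g =
  +-mono-<-≤ l (sumFin-mono (h ∘ suc))
sumFin-mono-< {suc n} {f} {g} h (suc i) l rewrite sumFin-suc f | sumFin-suc g =
  +-mono-≤-< (h zero) (sumFin-mono-< (h ∘ suc) i l)

sumFin-cong : ∀ {n} {f g : Fin n → ℕ} → (∀ i → f i ≡ g i) → sumFin f ≡ sumFin g
sumFin-cong h = ≤-antisym (sumFin-mono (≤-reflexive ∘ h)) (sumFin-mono (≤-reflexive ∘ sym ∘ h))

+-interchange : ∀ a b c d → (a + b) + (c + d) ≡ (a + c) + (b + d)
+-interchange = solve-∀

sumFin-+ : ∀ {n} (f g : Fin n → ℕ) → sumFin (λ i → f i + g i) ≡ sumFin f + sumFin g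
sumFin-+ {zero}  f g = refl
sumFin-+ {suc n} f g
  rewrite sumFin-suc (λ i → f i + g i) | sumFin-suc f | sumFin-suc g | sumFin-+ (f ∘ suc) (g ∘ suc)
  = +-interchange (f zero) (g zero) (sumFin (f ∘ suc)) (sumFin (g ∘ suc))

sumFin-*ʳ : ∀ {n} (f : Fin n → ℕ) c → sumFin (λ i → f i * c) ≡ sumFin f * c
sumFin-*ʳ {zero}  f c = refl
sumFin-*ʳ {suc n} f c
  rewrite sumFin-suc (λ i → f i * c) | sumFin-suc f | sumFin-*ʳ (f ∘ suc) c
  = sym (*-distribʳ-+ c (f zero) (sumFin (f ∘ suc)))

sumFin-zero : ∀ {n} → sumFin {n} (λ _ → 0) ≡ 0
sumFin-zero {n} = trans (sumFin-*ʳ {n} (λ _ → 0) 0) (*-zeroʳ (sumFin {n} (λ _ → 0)))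

sumFin-swap : ∀ {m n} (f : Fin m → Fin n → ℕ) →
              sumFin (λ i → sumFin (f i)) ≡ sumFin (λ j → sumFin (λ i → f i j))
sumFin-swap {zero}  {n} f = sym (sumFin-zero {n})
sumFin-swap {suc m} {n} f = begin
  sumFin (λ i → sumFin (f i))                                  ≡⟨ sumFin-suc (λ i → sumFin (f i)) ⟩
  sumFin (f zero) + sumFin (λ i → sumFin (f (suc i)))          ≡⟨ cong (sumFin (f zero) +_) (sumFin-swap (f ∘ suc)) ⟩
  sumFin (f zero) + sumFin (λ j → sumFin (λ i → f (suc i) j))  ≡⟨ sumFin-+ (f zero) _ ⟨
  sumFin (λ j → f zero j + sumFin (λ i → f (suc i) j))         ≡⟨ sumFin-cong (λ j → sym (sumFin-suc (λ i → f i j))) ⟩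
  sumFin (λ j → sumFin (λ i → f i j))                          ∎
  where open ≡-Reasoning

term≤sumFin : ∀ {n} (f : Fin n → ℕ) i → f i ≤ sumFin f
term≤sumFin f zero    rewrite sumFin-suc f = m≤m+n _ _
term≤sumFin f (suc i) rewrite sumFin-suc f = ≤-trans (term≤sumFin (f ∘ suc) i) (m≤n+m _ _)

two-terms≤sumFin : ∀ {n} (f : Fin n → ℕ) {i j} → i ≢ j → f i + f j ≤ sumFin f
two-terms≤sumFin f {zero}  {zero}  i≢j with () ← i≢j refl
two-terms≤sumFin f {zero}  {suc j} i≢j rewrite sumFin-suc f = +-monoʳ-≤ (f zero) (term≤sumFin (f ∘ suc) j)
two-terms≤sumFin f {suc i} {zero}  i≢j rewrite sumFin-suc f | +-comm (f (suc i)) (f zero) =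
  +-monoʳ-≤ (f zero) (term≤sumFin (f ∘ suc) i)
two-terms≤sumFin f {suc i} {suc j} i≢j rewrite sumFin-suc f =
  ≤-trans (two-terms≤sumFin (f ∘ suc) (i≢j ∘ cong suc)) (m≤n+m _ _)

count-mono : ∀ {n} {p q : Fin n → Bool} → (∀ i → T (p i) → T (q i)) → count p ≤ count q
count-mono h = sumFin-mono (λ i → []-mono (h i))

[]<[] : ∀ {a b} → ¬ T a → T b → [ a ] < [ b ]
[]<[] {false} {true} _  _ = ≤-refl
[]<[] {true}         ¬a _ with () ← ¬a tt

count-mono-< : ∀ {n} {p q : Fin n → Bool} → (∀ i → T (p i) → T (q i)) →
               ∀ i → ¬ T (p i) → T (q i) → count p < count q
count-mono-< h i ¬p q = sumFin-mono-< (λ j → []-mono (h j)) i ([]<[] ¬p q)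

count-pos : ∀ {n} (p : Fin n → Bool) i → T (p i) → 1 ≤ count p
count-pos p i pi = ≤-trans ([]<[] {false} id pi) (term≤sumFin (λ j → [ p j ]) i)

_∖_ : ∀ {n} → (Fin n → Bool) → Fin n → Fin n → Bool
(p ∖ i) j = p j ∧ does (¬? (j ≟ i))

∖⁺ : ∀ {n} (p : Fin n → Bool) {i j} → T (p j) → j ≢ i → T ((p ∖ i) j)
∖⁺ p {i} {j} pj j≢i = T-∧⁺ pj (does⁺ (¬? (j ≟ i)) j≢i)

∖⁻ : ∀ {n} (p : Fin n → Bool) {i j} → T ((p ∖ i) j) → T (p j) × j ≢ i
∖⁻ p {i} {j} h with pj , d ← T-∧⁻ {p j} h = pj , does⁻ (¬? (j ≟ i)) d

count-∖< : ∀ {n} (p : Fin n → Bool) {i} → T (p i) → count (p ∖ i) < count p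
count-∖< p {i} pi = count-mono-< (λ j h → let pj , _ = ∖⁻ p h in pj) i
  (λ h → let _ , i≢i = ∖⁻ p h in i≢i refl) pi

count-∖ : ∀ {n} (p : Fin n → Bool) i → count p ≤ suc (count (p ∖ i))
count-∖ {suc n} p zero
  rewrite sumFin-suc (λ j → [ p j ]) | sumFin-suc (λ j → [ (p ∖ zero) j ]) =
  +-mono-≤ ([]-mono {p zero} {true} _)
    (≤-trans (count-mono {p = p ∘ suc} {(p ∖ zero) ∘ suc} (λ j pj → ∖⁺ p {zero} {suc j} pj λ ())) (m≤n+m _ _))
count-∖ {suc n} p (suc i)
  rewrite sumFin-suc (λ j → [ p j ]) | sumFin-suc (λ j → [ (p ∖ suc i) j ]) = begin
  [ p zero ] + count (p ∘ suc)                       ≤⟨ +-mono-≤ ([]-mono {p zero} {(p ∖ suc i) zero} (λ t → ∖⁺ p {suc i} {zero} t λ ())) (count-∖ (p ∘ suc) i) ⟩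
  [ (p ∖ suc i) zero ] + suc (count ((p ∘ suc) ∖ i)) ≡⟨ +-suc _ _ ⟩
  suc ([ (p ∖ suc i) zero ] + count ((p ∘ suc) ∖ i)) ∎
  where open ≤-Reasoning

-- Induction on the domain of `f`: an index satisfying `q` accounts for at most one element of `p`,
-- which is then removed.
count-image : ∀ {m n} (p : Fin n → Bool) (q : Fin m → Bool) (f : Fin m → Fin n) →
              (∀ i → T (p i) → ∃ λ j → T (q j) × f j ≡ i) → count p ≤ count q
count-image {zero} {n} p q f h =
  ≤-trans (count-mono {p = p} {λ _ → false} λ i pi → case-absurd (h i pi)) (≤-reflexive (sumFin-zero {n}))
  where case-absurd : ∀ {A : Set} {P : Fin 0 → Set} → ∃ P → A
        case-absurd (() , _)
count-image {suc m} p q f h rewrite sumFin-suc (λ j → [ q j ]) with q zero in eq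
... | true  = ≤-trans (count-∖ p (f zero)) (s≤s (count-image (p ∖ f zero) (q ∘ suc) (f ∘ suc) h′))
  where
  h′ : ∀ i → T ((p ∖ f zero) i) → ∃ λ j → T (q (suc j)) × f (suc j) ≡ i
  h′ i t with pi , i≢ ← ∖⁻ p t with h i pi
  ... | zero  , _  , refl with () ← i≢ refl
  ... | suc j , qj , fj≡i = j , qj , fj≡i
... | false = count-image p (q ∘ suc) (f ∘ suc) h′
  where
  h′ : ∀ i → T (p i) → ∃ λ j → T (q (suc j)) × f (suc j) ≡ i
  h′ i pi with h i pi
  ... | zero  , q0 , _ with () ← subst T eq q0
  ... | suc j , qj , fj≡i = j , qj , fj≡i

count-witness : ∀ {n} (p : Fin n → Bool) → 1 ≤ count p → ∃ λ i → T (p i)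
count-witness {suc n} p 1≤ rewrite sumFin-suc (λ j → [ p j ]) with p zero in eq
... | true  = zero , subst T (sym eq) tt
... | false = let i , pi = count-witness (p ∘ suc) 1≤ in suc i , pi

count-witness-≢ : ∀ {n} (p : Fin n → Bool) → 2 ≤ count p → ∀ i → ∃ λ j → T (p j) × j ≢ i
count-witness-≢ p 2≤ i =
  let j , h = count-witness (p ∖ i) (s≤s⁻¹ (≤-trans 2≤ (count-∖ p i))) in j , ∖⁻ p h

count≥2 : ∀ {n} (p : Fin n → Bool) {i j} → T (p i) → T (p j) → i ≢ j → 2 ≤ count p
count≥2 p {i} {j} pi pj i≢j = ≤-trans (s≤s (count-pos (p ∖ i) j (∖⁺ p pj (i≢j ∘ sym)))) (count-∖< p pi)

count≤2-cover : ∀ {n} (p : Fin n → Bool) → count p ≤ 2 → ∀ {i j} → T (p i) → T (p j) → i ≢ j →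
                ∀ k → T (p k) → k ≡ i ⊎ k ≡ j
count≤2-cover p ≤2 {i} {j} pi pj i≢j k pk with k ≟ i | k ≟ j
... | yes k≡i | _       = inj₁ k≡i
... | no _    | yes k≡j = inj₂ k≡j
... | no k≢i  | no k≢j  = contradiction 3≤ (≤⇒≯ ≤2)
  where
  3≤ : 3 ≤ count p
  3≤ = ≤-trans (s≤s (count≥2 (p ∖ i) (∖⁺ p pj (i≢j ∘ sym)) (∖⁺ p pk k≢i) (k≢j ∘ sym))) (count-∖< p pi)

count-cover : ∀ {n} (p q : Fin n → Bool) → (∀ i → T (p i) ⊎ T (q i)) → n ≤ count p + count q
count-cover {n} p q h = begin
  n                                   ≡⟨ ones n ⟩
  sumFin {n} (λ _ → 1)                ≤⟨ sumFin-mono (λ i → one≤ (h i)) ⟩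
  sumFin (λ i → [ p i ] + [ q i ])    ≡⟨ sumFin-+ (λ i → [ p i ]) (λ i → [ q i ]) ⟩
  count p + count q                   ∎
  where
  open ≤-Reasoning
  ones : ∀ n → n ≡ sumFin {n} (λ _ → 1)
  ones zero    = refl
  ones (suc n) = trans (cong suc (ones n)) (sym (sumFin-suc {n} (λ _ → 1)))
  one≤ : ∀ {a b} → T a ⊎ T b → 1 ≤ [ a ] + [ b ]
  one≤ {true}         _        = s≤s z≤n
  one≤ {false} {true} (inj₂ _) = ≤-refl
  one≤ {false} {false} (inj₁ ())
  one≤ {false} {false} (inj₂ ())

-- Alternating walks and bichromatic cycles

Adj : ∀ {n} → Graph n → Fin n → Fin n → Set
Adj G u v = T (adj G u v)

Adj-sym : ∀ {n} (G : Graph n) {u v} → Adj G u v → Adj G v u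
Adj-sym G {u} {v} = subst T (adj-sym G u v)

opaque
  -- Stands for `G − x`, with `x` kept as an isolated vertex, so that the vertex set stays `Fin n`
  -- and colourings need no renaming.
  isolate : ∀ {n} → Fin n → Graph n → Graph n
  isolate x G .adj u v = does (¬? (u ≟ x)) ∧ (does (¬? (v ≟ x)) ∧ adj G u v)
  isolate x G .adj-sym u v with u ≟ x | v ≟ x
  ... | yes _ | yes _ = refl
  ... | yes _ | no _  = refl
  ... | no _  | yes _ = refl
  ... | no _  | no _  = adj-sym G u v
  isolate x G .irrefl v with v ≟ x
  ... | yes _ = refl
  ... | no _  = irrefl G v

module _ {n} (x : Fin n) (G : Graph n) where

  opaque
    unfolding isolate

    isolate⁺ : ∀ {u v} → u ≢ x → v ≢ x → Adj G u v → Adj (isolate x G) u v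
    isolate⁺ {u} {v} u≢x v≢x uv =
      T-∧⁺ (does⁺ (¬? (u ≟ x)) u≢x) (T-∧⁺ (does⁺ (¬? (v ≟ x)) v≢x) uv)

    isolate⁻ : ∀ {u v} → Adj (isolate x G) u v → u ≢ x × v ≢ x × Adj G u v
    isolate⁻ {u} {v} h with a , b ← T-∧⁻ {does (¬? (u ≟ x))} h with c , d ← T-∧⁻ {does (¬? (v ≟ x))} b =
      does⁻ (¬? (u ≟ x)) a , does⁻ (¬? (v ≟ x)) c , d

  isolate⊆ : ∀ {u v} → Adj (isolate x G) u v → Adj G u v
  isolate⊆ uv = proj₂ (proj₂ (isolate⁻ uv))

  degree-isolate : ∀ v → degree (isolate x G) v ≤ degree G v
  degree-isolate v = count-mono (λ w → isolate⊆ {v} {w})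

  degree-isolate-< : ∀ {v} → Adj G v x → degree (isolate x G) v < degree G v
  degree-isolate-< {v} vx = count-mono-< (λ w → isolate⊆ {v} {w}) x
    (λ h → proj₁ (proj₂ (isolate⁻ {v} {x} h)) refl) vx

module _ {n k} {G : Graph n} (χ : EdgeColouring G k) where

  Sees : Fin n → Fin k → Set
  Sees v c = ∃ λ w → Adj G v w × col χ v w ≡ c

  sees? : ∀ v c → Dec (Sees v c)
  sees? v c = any? λ w → T? (adj G v w) ×-dec (col χ v w ≟ c)

  -- Vertices may repeat; a walk of given length can then be searched for one edge at a time.
  Alt : ℕ → Fin k → Fin k → Fin n → Fin n → Set
  Alt zero    p q u v = u ≡ v
  Alt (suc l) p q u v = ∃ λ w → Adj G u w × col χ u w ≡ p × Alt l q p w v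

  alt? : ∀ l p q u v → Dec (Alt l p q u v)
  alt? zero    p q u v = u ≟ v
  alt? (suc l) p q u v = any? λ w → T? (adj G u w) ×-dec ((col χ u w ≟ p) ×-dec alt? l q p w v)

  Alt-sees : ∀ {l p q u v} → u ≢ v → Alt l p q u v → Sees u p
  Alt-sees {zero}  u≢v u≡v with () ← u≢v u≡v
  Alt-sees {suc l} u≢v (w , uw , c , _) = w , uw , c

-- The colour of the last edge of an alternating walk of length l with colours p, q, p, …
-- (and q if l = 0).
lastColour : ∀ {A : Set} → ℕ → A → A → A
lastColour zero    p q = q
lastColour (suc l) p q = lastColour l q p

lastColour-involutive : ∀ {A : Set} l (p q : A) → lastColour l (lastColour l p q) (lastColour l q p) ≡ p
lastColour-involutive zero    p q = refl
lastColour-involutive (suc l) p q = lastColour-involutive l p q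

-- The parity of `l` decides whether a walk read backwards begins with `p` or with `q`.
lastColour-either : ∀ {A : Set} (P : A → A → Set) l p q →
                    P (lastColour l p q) (lastColour l q p) → P p q ⊎ P q p
lastColour-either P zero    p q = inj₂
lastColour-either P (suc l) p q = swap ∘ lastColour-either P l q p

module _ {n k} {G : Graph n} (χ : EdgeColouring G k) where

  Alt-snoc : ∀ l {p q u v w} → Alt χ l p q u v → Adj G v w → col χ v w ≡ lastColour (suc l) p q →
             Alt χ (suc l) p q u w
  Alt-snoc zero    refl                  vw e = _ , vw , e , refl
  Alt-snoc (suc l) (t , ut , c , walk) vw e = t , ut , c , Alt-snoc l walk vw e

  Alt-reverse′ : ∀ l {p q u v} → Alt χ l p q u v → Alt χ l (lastColour l p q) (lastColour l q p) v u
  Alt-reverse′ zero    refl = refl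
  Alt-reverse′ (suc l) {p} {q} (w , uw , c , walk) =
    Alt-snoc l (Alt-reverse′ l walk) (Adj-sym G uw)
      (trans (sym (colSym χ _ _ uw)) (trans c (sym (lastColour-involutive l p q))))

  Alt-reverse : ∀ l {p q u v} → Alt χ l p q u v → Alt χ l p q v u ⊎ Alt χ l q p v u
  Alt-reverse l {p} {q} {u} {v} walk =
    lastColour-either (λ p q → Alt χ l p q v u) l p q (Alt-reverse′ l walk)

  -- Read backwards, the walk leaves `v` with `p` or with `q`. Since `u ≢ v` it has a first edge,
  -- and `v` misses `p`.
  Alt-reverse-unseen : ∀ l {p q u v} → u ≢ v → ¬ Sees χ v p → Alt χ l p q u v → Alt χ l q p v u
  Alt-reverse-unseen l u≢v v∌p walk with Alt-reverse l walk
  ... | inj₁ walk′ = contradiction (Alt-sees χ {l} (u≢v ∘ sym) walk′) v∌p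
  ... | inj₂ walk′ = walk′

-- `Cycle` and `Bichromatic` in one record, indexed by a map on `m + 2` positions so that rotation
-- visibly preserves the length.
record BichromaticCycle {n k} {G : Graph n} (χ : EdgeColouring G k) (a b : Fin k) {m}
                        (f : Fin (suc (suc m)) → Fin n) : Set where
  constructor bichromaticCycle
  field
    f-inj    : Injective _≡_ _≡_ f
    f-step   : ∀ i → Adj G (f (inject₁ i)) (f (suc i))
    f-close  : Adj G (f (fromℕ (suc m))) (f zero)
    c-step   : ∀ i → let c = col χ (f (inject₁ i)) (f (suc i)) in c ≡ a ⊎ c ≡ b
    c-close  : let c = col χ (f (fromℕ (suc m))) (f zero) in c ≡ a ⊎ c ≡ b

open BichromaticCycle

rotate : ∀ {A : Set} {m} → (Fin (suc m) → A) → Fin (suc m) → A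
rotate {m = m} f zero    = f (fromℕ m)
rotate         f (suc i) = f (inject₁ i)

module _ {n k} {G : Graph n} (χ : EdgeColouring G k) {a b : Fin k} where

  rotate-cycle : ∀ {m} {f : Fin (suc (suc m)) → Fin n} →
                 BichromaticCycle χ a b f → BichromaticCycle χ a b (rotate f)
  rotate-cycle {m} {f} C = record
    { f-inj = inj′ ; f-step = step′ ; f-close = f-step C (fromℕ m) ; c-step = c-step′ ; c-close = c-step C (fromℕ m) }
    where
    inj′ : Injective _≡_ _≡_ (rotate f)
    inj′ {zero}  {zero}  _ = refl
    inj′ {zero}  {suc j} e = contradiction (f-inj C e) fromℕ≢inject₁
    inj′ {suc i} {zero}  e = contradiction (sym (f-inj C e)) fromℕ≢inject₁
    inj′ {suc i} {suc j} e = cong suc (inject₁-injective (f-inj C e))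
    step′ : ∀ i → Adj G (rotate f (inject₁ i)) (rotate f (suc i))
    step′ zero    = f-close C
    step′ (suc i) = f-step C (inject₁ i)
    c-step′ : ∀ i → let c = col χ (rotate f (inject₁ i)) (rotate f (suc i)) in c ≡ a ⊎ c ≡ b
    c-step′ zero    = c-close C
    c-step′ (suc i) = c-step C (inject₁ i)

  -- Downward induction on `i`: one rotation puts the last vertex first and moves the vertex at
  -- `inject₁ i` to `suc i`.
  start-at : ∀ {m} i (f : Fin (suc (suc m)) → Fin n) → BichromaticCycle χ a b f →
             ∃ λ (f′ : Fin (suc (suc m)) → Fin n) → BichromaticCycle χ a b f′ × f′ zero ≡ f i
  start-at {m} = >-weakInduction
    (λ i → ∀ (f : Fin (suc (suc m)) → Fin n) → BichromaticCycle χ a b f →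
       ∃ λ (f′ : Fin (suc (suc m)) → Fin n) → BichromaticCycle χ a b f′ × f′ zero ≡ f i)
    (λ f C → rotate f , rotate-cycle C , refl)
    (λ i IH f C → IH (rotate f) (rotate-cycle C))

pair-covers : ∀ {A : Set} {a b p q r : A} → p ≢ q → p ≡ a ⊎ p ≡ b → q ≡ a ⊎ q ≡ b → r ≡ a ⊎ r ≡ b → r ≡ p ⊎ r ≡ q
pair-covers p≢q (inj₁ refl) (inj₁ refl) _ with () ← p≢q refl
pair-covers p≢q (inj₁ refl) (inj₂ refl) r = r
pair-covers p≢q (inj₂ refl) (inj₁ refl) r = swap r
pair-covers p≢q (inj₂ refl) (inj₂ refl) _ with () ← p≢q refl

-- Extending a colouring to a deleted vertex

module _ {n k : ℕ} {G : Graph n} where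

  restrict : ∀ x → EdgeColouring G k → EdgeColouring (isolate x G) k
  restrict x χ .col          = col χ
  restrict x χ .colSym u v h = colSym χ u v (isolate⊆ x G h)

  restrict-acyclic : ∀ x χ → Acyclic χ → Acyclic (restrict x χ)
  restrict-acyclic x χ (pr , ac) =
    (λ u v w uv uw → pr u v w (isolate⊆ x G uv) (isolate⊆ x G uw)) ,
    λ C → ac record { len = len C ; len≥2 = len≥2 C ; vtx = vtx C ; inj = inj C
                    ; step = λ i → isolate⊆ x G (step C i) ; close = isolate⊆ x G (close C) }

module Extension {n k} {G : Graph n} (x : Fin n) (χ : EdgeColouring (isolate x G) k) (g : Fin n → Fin k) where

  extCol : Fin n → Fin n → Fin k
  extCol u v = if does (u ≟ x) then g v else if does (v ≟ x) then g u else col χ u v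

  extCol-x : ∀ v → extCol x v ≡ g v
  extCol-x v with x ≟ x
  ... | yes _  = refl
  ... | no x≢x with () ← x≢x refl

  extCol-off : ∀ {u v} → u ≢ x → v ≢ x → extCol u v ≡ col χ u v
  extCol-off {u} {v} u≢x v≢x with u ≟ x | v ≟ x
  ... | no _    | no _    = refl
  ... | yes u≡x | _       with () ← u≢x u≡x
  ... | no _    | yes v≡x with () ← v≢x v≡x

  extend : EdgeColouring G k
  extend .col = extCol
  extend .colSym u v uv with u ≟ x | v ≟ x
  ... | yes u≡x | yes v≡x = cong g (trans v≡x (sym u≡x))
  ... | yes _   | no _    = refl
  ... | no _    | yes _   = refl
  ... | no u≢x  | no v≢x  = colSym χ u v (isolate⁺ x G u≢x v≢x uv)

  module _ (χ-acyclic : Acyclic χ)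
           (g-inj  : ∀ {v w} → Adj G x v → Adj G x w → v ≢ w → g v ≢ g w)
           (g-free : ∀ {v} → Adj G x v → ¬ Sees χ v (g v))
           (no-alt : ∀ {v w} → Adj G x v → Adj G x w → v ≢ w → ∀ {l} → l < n → ¬ Alt χ l (g w) (g v) v w)
    where

    extend-proper : Proper extend
    extend-proper u v w uv uw v≢w e with u ≟ x | v ≟ x | w ≟ x
    ... | yes refl | _        | _        = g-inj uv uw v≢w e
    ... | no _     | yes refl | yes refl = v≢w refl
    ... | no u≢x   | yes refl | no w≢x   =
      g-free (Adj-sym G uv) (w , isolate⁺ x G u≢x w≢x uw , sym e)
    ... | no u≢x   | no v≢x   | yes refl =
      g-free (Adj-sym G uw) (v , isolate⁺ x G u≢x v≢x uv , e)
    ... | no u≢x   | no v≢x   | no w≢x   =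
      proj₁ χ-acyclic u v w (isolate⁺ x G u≢x v≢x uv) (isolate⁺ x G u≢x w≢x uw) v≢w e

    -- The edge from `w` into `f zero` has colour `p`, so by properness the next edge has `q`. The
    -- induction continues with `f zero` in the role of `w`.
    alternates : ∀ m (f : Fin (suc m) → Fin n) {w p q} → (∀ i → f i ≢ x) → Injective _≡_ _≡_ f →
                 (∀ i → Adj G (f (inject₁ i)) (f (suc i))) →
                 (∀ i → let c = extCol (f (inject₁ i)) (f (suc i)) in c ≡ p ⊎ c ≡ q) →
                 Adj G (f zero) w → extCol (f zero) w ≡ p → (∀ i → w ≢ f i) →
                 Alt χ m q p (f zero) (f (fromℕ m))
    alternates zero    f f≢x inj step cols fw c w≢f = refl
    alternates (suc m) f f≢x inj step cols fw c w≢f with cols zero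
    ... | inj₁ c′ = contradiction (trans c (sym c′))
                      (extend-proper (f zero) _ (f (suc zero)) fw (step zero) (w≢f (suc zero)))
    ... | inj₂ c′ = f (suc zero) , isolate⁺ x G (f≢x zero) (f≢x (suc zero)) (step zero) ,
                    trans (sym (extCol-off (f≢x zero) (f≢x (suc zero)))) c′ ,
                    alternates m (f ∘ suc) (f≢x ∘ suc) (suc-injective ∘ inj) (step ∘ suc) (swap ∘ cols ∘ suc)
                      (Adj-sym G (step zero)) (trans (sym (colSym extend _ _ (step zero))) c′)
                      (λ i e → 0≢1+n (inj e))

    -- The part of the cycle outside `x` is an alternating walk between two neighbours of `x`, of
    -- the kind that `no-alt` excludes. It has `m` edges, and `m + 2` distinct vertices force
    -- `m < n`; `1 ≤ m` makes the two neighbours distinct.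
    cycle-avoids : ∀ {a b m} (f : Fin (suc (suc m)) → Fin n) → 1 ≤ m → BichromaticCycle extend a b f → f zero ≢ x
    cycle-avoids {m = m} f 1≤m C f0≡x =
      no-alt xv xw v≢w m<n (subst₂ (λ q p → Alt χ m q p v w) (gcol w) (gcol v)
        (alternates m (f ∘ suc) (λ i e → 0≢1+n (f-inj C (trans f0≡x (sym e))))
          (suc-injective ∘ f-inj C) (f-step C ∘ suc)
          -- The two cycle edges at `x` have different colours, so these are the only two colours of
          -- the cycle.
          (λ i → pair-covers p≢q (c-step C zero) (map⊎ (trans wcol) (trans wcol) (c-close C)) (c-step C (suc i)))
          (Adj-sym G (f-step C zero)) (sym (colSym extend _ _ (f-step C zero)))
          (λ i e → 0≢1+n (f-inj C e))))
      where
      v w : Fin n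
      v = f (suc zero)
      w = f (fromℕ (suc m))
      xv : Adj G x v
      xv = subst (λ t → Adj G t v) f0≡x (f-step C zero)
      xw : Adj G x w
      xw = subst (λ t → Adj G t w) f0≡x (Adj-sym G (f-close C))
      zero≢last : ∀ {m} → 1 ≤ m → Fin.zero ≢ fromℕ m
      zero≢last (s≤s _) ()
      v≢w : v ≢ w
      v≢w e = zero≢last 1≤m (suc-injective (f-inj C e))
      m<n : m < n
      m<n = ≤-trans (n≤1+n _) (injective⇒≤ (f-inj C))
      gcol : ∀ t → extCol (f zero) t ≡ g t
      gcol t = trans (cong (λ s → extCol s t) f0≡x) (extCol-x t)
      wcol : extCol (f zero) w ≡ extCol w (f zero)
      wcol = sym (colSym extend _ _ (f-close C))
      p≢q : extCol (f zero) v ≢ extCol (f zero) w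
      p≢q e = g-inj xv xw v≢w (trans (sym (gcol v)) (trans e (gcol w)))

    extend-acyclic : Acyclic extend
    extend-acyclic = extend-proper , no-cycle
      where
      no-cycle : ∀ C → ¬ Bichromatic extend C
      no-cycle record { len = suc m ; len≥2 = s≤s 1≤m ; vtx = f ; inj = inj ; step = step ; close = close }
               (a , b , cs , cc) = proj₂ χ-acyclic C′ (a , b , cs′ , cc′)
        where
        C₀ : BichromaticCycle extend a b f
        C₀ = bichromaticCycle inj step close cs cc
        f≢x : ∀ i → f i ≢ x
        -- A cycle through `x` can be rotated until it starts there.
        f≢x i fi≡x with f′ , C₁ , e ← start-at extend i f C₀ = cycle-avoids f′ 1≤m C₁ (trans e fi≡x)
        C′ : Cycle (isolate x G)
        C′ = record { len = suc m ; len≥2 = s≤s 1≤m ; vtx = f ; inj = inj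
                    ; step = λ i → isolate⁺ x G (f≢x _) (f≢x _) (step i)
                    ; close = isolate⁺ x G (f≢x _) (f≢x _) close }
        cs′ : ∀ i → let c = col χ (f (inject₁ i)) (f (suc i)) in c ≡ a ⊎ c ≡ b
        cs′ i = subst (λ c → c ≡ a ⊎ c ≡ b) (extCol-off (f≢x _) (f≢x _)) (cs i)
        cc′ : let c = col χ (f (fromℕ (suc m))) (f zero) in c ≡ a ⊎ c ≡ b
        cc′ = subst (λ c → c ≡ a ⊎ c ≡ b) (extCol-off (f≢x _) (f≢x _)) cc

-- Vertices of degree 2

-- Merges a case distinction for every colour or vertex into one: either some index yields a
-- colouring or all of them are obstructed.
∀-⊎ : ∀ {n} {P : Fin n → Set} {Q : Set} → (∀ i → P i ⊎ Q) → (∀ i → P i) ⊎ Q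
∀-⊎ {zero}  h = inj₁ λ ()
∀-⊎ {suc n} h with h zero | ∀-⊎ (h ∘ suc)
... | inj₂ q | _      = inj₂ q
... | inj₁ _ | inj₂ q = inj₂ q
... | inj₁ p | inj₁ ps = inj₁ λ { zero → p ; (suc i) → ps i }

-- Linear arithmetic by summing inequalities into `l ≤ r` and cancelling the common part `s`; the
-- two rearrangements are left to the ring solver.
cancel-≤ : ∀ s {a b l r} → l ≤ r → a + s ≡ l → r ≡ b + s → a ≤ b
cancel-≤ s l≤r refl refl = +-cancelʳ-≤ s _ _ l≤r

module _ {n k} {G : Graph n} (χ : EdgeColouring G k) where

  seen unseen : Fin n → Fin k → Bool
  seen   v c = does (sees? χ v c)
  unseen v c = does (¬? (sees? χ v c))

  count-seen≤degree : ∀ v → count (seen v) ≤ degree G v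
  count-seen≤degree v = count-image (seen v) (adj G v) (col χ v) (λ c → does⁻ (sees? χ v c))

  colours≤unseen+seen : ∀ v → k ≤ count (unseen v) + count (seen v)
  colours≤unseen+seen v = count-cover (unseen v) (seen v) split
    where
    split : ∀ c → T (unseen v c) ⊎ T (seen v c)
    split c with sees? χ v c
    ... | yes _ = inj₂ tt
    ... | no _  = inj₁ tt

  colours≤unseen+degree : ∀ v → k ≤ count (unseen v) + degree G v
  colours≤unseen+degree v = ≤-trans (colours≤unseen+seen v) (+-monoʳ-≤ (count (unseen v)) (count-seen≤degree v))

  -- Colouring `xy` with `a` and `xz` with `c` would close such a walk through `x` to a bichromatic
  -- cycle.
  Blocked : Fin n → Fin n → Set
  Blocked y z = ∀ a c → ¬ Sees χ y a → ¬ Sees χ z c → a ≢ c → ∃ λ l → Alt χ l a c z y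

  Blocked-sym : ∀ {y z} → y ≢ z → Blocked y z → Blocked z y
  Blocked-sym y≢z blk a c z∌a y∌c a≢c with l , walk ← blk c a y∌c z∌a (a≢c ∘ sym) =
    l , Alt-reverse-unseen χ l (y≢z ∘ sym) y∌c walk

  -- A maximal alternating walk, which in a proper colouring is determined by its start.
  data MaxAlt : Fin k → Fin k → Fin n → Fin n → Set where
    stop : ∀ {p q u} → ¬ Sees χ u p → MaxAlt p q u u
    move : ∀ {p q u v w} → Adj G u w → col χ u w ≡ p → MaxAlt q p w v → MaxAlt p q u v

  MaxAlt-unique : Proper χ → ∀ {p q u v v′} → MaxAlt p q u v → MaxAlt p q u v′ → v ≡ v′
  MaxAlt-unique pr (stop _)      (stop _)       = refl
  MaxAlt-unique pr (stop u∌p)    (move uw c _)  = contradiction (_ , uw , c) u∌p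
  MaxAlt-unique pr (move uw c _) (stop u∌p)     = contradiction (_ , uw , c) u∌p
  MaxAlt-unique pr (move {u = u} {w = w} uw c walk) (move {w = w′} uw′ c′ walk′) with w ≟ w′
  ... | yes refl = MaxAlt-unique pr walk walk′
  ... | no w≢w′  = contradiction (trans c (sym c′)) (pr u w w′ uw uw′ w≢w′)

-- Cut an alternating walk into y, which misses a, just before y: what remains is maximal once
-- y is deleted, and it ends in the c-neighbour t of y.
module _ {n k} {K : Graph n} (y : Fin n) (χ : EdgeColouring (isolate y K) k)
         (χ⁺ : EdgeColouring K k) (χ⁺-proper : Proper χ⁺)
         (agree : ∀ {u v} → Adj (isolate y K) u v → col χ⁺ u v ≡ col χ u v)
         {a c : Fin k} (y∌a : ¬ Sees χ⁺ y a) {t : Fin n} (yt : Adj K y t) (yt-c : col χ⁺ y t ≡ c)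
  where

  private
    enters : ∀ {p u} → Adj K u y → col χ⁺ u y ≡ p → p ≡ a ⊎ p ≡ c → u ≡ t
    enters {p} {u} uy e pc with colSym χ⁺ u y uy | pc
    ... | s | inj₁ refl = contradiction (u , Adj-sym K uy , trans (sym s) e) y∌a
    ... | s | inj₂ refl with u ≟ t
    ...   | yes u≡t = u≡t
    ...   | no u≢t  = contradiction (trans (trans (sym s) e) (sym yt-c)) (χ⁺-proper y u t (Adj-sym K uy) yt u≢t)

  truncate : ∀ l {p q u} → p ≡ a ⊎ p ≡ c → q ≡ a ⊎ q ≡ c → u ≢ y → Alt χ⁺ l p q u y → MaxAlt χ p q u t
  truncate zero    pc qc u≢y u≡y = contradiction u≡y u≢y
  truncate (suc l) {p} {q} {u} pc qc u≢y (w , uw , e , walk) with w ≟ y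
  ... | no w≢y = let uw′ = isolate⁺ y K u≢y w≢y uw in
                 move uw′ (trans (sym (agree uw′)) e) (truncate l qc pc w≢y walk)
  -- The edge from `u` to `y` is the only one at `u` with colour `p` and is lost with `y`, so the
  -- walk is maximal here.
  ... | yes refl with refl ← enters uw e pc = stop u∌p
    where
    u∌p : ¬ Sees χ u p
    u∌p (v , uv , e′) = let _ , v≢y , uv⁺ = isolate⁻ y K uv in
      χ⁺-proper u v y uv⁺ uw v≢y (trans (agree uv) (trans e′ (sym e)))

twos : ∀ {n} → Graph n → Fin n → ℕ
twos G v = count (λ w → adj G v w ∧ does (degree G w ≟ℕ 2))

-- Without its edge to `x`, the vertex `v` has degree at most `D - 1`, against `D + 1` colours.
two-colours-unseen : ∀ {n D} (G : Graph n) → (∀ v → degree G v ≤ D) → ∀ {x} (χ : EdgeColouring (isolate x G) (suc D)) →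
                     ∀ {v} → Adj G x v → 2 ≤ count (unseen χ v)
two-colours-unseen {D = D} G bounded {x} χ {v} xv = cancel-≤ (D + d)
  (+-mono-≤ (colours≤unseen+degree χ v) (≤-trans (degree-isolate-< x G (Adj-sym G xv)) (bounded v)))
  (eq₁ D d) (eq₂ (count (unseen χ v)) d D)
  where
  d : ℕ
  d = degree (isolate x G) v
  eq₁ : ∀ D d → 2 + (D + d) ≡ suc D + suc d
  eq₁ = solve-∀
  eq₂ : ∀ u d D → u + d + D ≡ u + (D + d)
  eq₂ = solve-∀

module TwoVertex {n D} (G : Graph n) (bounded : ∀ v → degree G v ≤ D)
                 {x y z : Fin n} (xy : Adj G x y) (xz : Adj G x z) (y≢z : y ≢ z) where

  K : Graph n
  K = isolate x G

  degK : ∀ {v} → Adj G x v → degree K v < degree G v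
  degK xv = degree-isolate-< x G (Adj-sym G xv)

  unseen≥2 : (χ : EdgeColouring K (suc D)) → ∀ {v} → Adj G x v → 2 ≤ count (unseen χ v)
  unseen≥2 χ = two-colours-unseen G bounded χ

  -- Degree inequalities at a blocked vertex

  module Degrees (χ : EdgeColouring K (suc D)) (χ-acyclic : Acyclic χ) (blocked : Blocked χ y z) where

    reversed : ∀ {a c} → ¬ Sees χ y a → ¬ Sees χ z c → a ≢ c → ∃ λ l → Alt χ l c a y z
    reversed {a} {c} y∌a z∌c a≢c with l , walk ← blocked a c y∌a z∌c a≢c =
      l , Alt-reverse-unseen χ l (y≢z ∘ sym) y∌a walk

    -- Two colours are missing at `y`, so one of them differs from `c`; the walk it gives from `y`
    -- to `z` begins with `c`.
    z∌⇒y∋ : ∀ {c} → ¬ Sees χ z c → Sees χ y c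
    z∌⇒y∋ {c} z∌c
      with a , y∌a , a≢c ← count-witness-≢ (unseen χ y) (unseen≥2 χ xy) c
      with l , walk ← reversed (does⁻ (¬? (sees? χ y a)) y∌a) z∌c a≢c = Alt-sees χ {l} y≢z walk

    unseen-distinct : ∀ {a c} → ¬ Sees χ y a → ¬ Sees χ z c → a ≢ c
    unseen-distinct y∌a z∌c refl = y∌a (z∌⇒y∋ z∌c)

    -- The walk from `y` to `z` begins with the edge `yw` and leaves `w` with colour `a`. It cannot
    -- end at `w`, because `z` misses `c`.
    neighbour-sees : ∀ {a c w} → ¬ Sees χ y a → ¬ Sees χ z c → Adj K y w → col χ y w ≡ c → Sees χ w a
    neighbour-sees {a} {c} {w} y∌a z∌c yw yw-c with reversed y∌a z∌c (unseen-distinct y∌a z∌c)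
    ... | zero  , y≡z = contradiction y≡z y≢z
    ... | suc l , w′ , yw′ , c′ , walk with w ≟ w′
    ...   | no w≢w′ = contradiction (trans yw-c (sym c′)) (proj₁ χ-acyclic y w w′ yw yw′ w≢w′)
    ...   | yes refl with w ≟ z
    ...     | no w≢z   = Alt-sees χ {l} w≢z walk
    ...     | yes refl = contradiction (y , Adj-sym K yw , trans (sym (colSym χ y w yw)) yw-c) z∌c

    unseen⊆seen : ∀ {c w} → ¬ Sees χ z c → Adj K y w → col χ y w ≡ c → ∀ a → T (unseen χ y a) → T (seen χ w a)
    unseen⊆seen z∌c yw yw-c a y∌a = does⁺ (sees? χ _ a) (neighbour-sees (does⁻ (¬? (sees? χ y a)) y∌a) z∌c yw yw-c)

    -- The additional colour is `c` itself, on the edge `yw`.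
    unseen<seen : ∀ {c w} → ¬ Sees χ z c → Adj K y w → col χ y w ≡ c → count (unseen χ y) < count (seen χ w)
    unseen<seen {c} {w} z∌c yw yw-c =
      count-mono-< (unseen⊆seen z∌c yw yw-c) c (λ t → does⁻ (¬? (sees? χ y c)) t (w , yw , yw-c))
        (does⁺ (sees? χ w c) (y , Adj-sym K yw , trans (sym (colSym χ y w yw)) yw-c))

    big : Fin n → Bool
    big w = adj K y w ∧ does (D + 3 ≤? degree G w + degree G y)

    -- At `y` more than `D + 1 - degree G y` colours are missing, and `w` sees all of them and `c`.
    neighbour-big : ∀ {c w} → ¬ Sees χ z c → Adj K y w → col χ y w ≡ c → D + 3 ≤ degree G w + degree G y
    neighbour-big {c} {w} z∌c yw yw-c = cancel-≤ (count (unseen χ y) + degree K y)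
      (+-mono-≤ (+-mono-≤ (colours≤unseen+degree χ y) (degK xy))
        (≤-trans (unseen<seen z∌c yw yw-c) (≤-trans (count-seen≤degree χ w) (degree-isolate x G w))))
      (eq₁ D (count (unseen χ y)) (degree K y)) (eq₂ (count (unseen χ y)) (degree K y) (degree G y) (degree G w))
      where
      eq₁ : ∀ D u d → D + 3 + (u + d) ≡ suc D + suc d + suc u
      eq₁ = solve-∀
      eq₂ : ∀ u d dy dw → u + d + dy + dw ≡ dw + dy + (u + d)
      eq₂ = solve-∀

    -- Every colour missing at `z` occurs at `y`, on an edge to a `big` neighbour.
    unseen≤big : count (unseen χ z) ≤ count big
    unseen≤big = count-image (unseen χ z) big (col χ y) λ c z∌c →
      let z∌c′ = does⁻ (¬? (sees? χ z c)) z∌c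
          w , yw , yw-c = z∌⇒y∋ z∌c′
      in w , T-∧⁺ yw (does⁺ (D + 3 ≤? degree G w + degree G y) (neighbour-big z∌c′ yw yw-c)) , yw-c

    -- The two kinds of neighbours are disjoint: a `big` vertex of degree 2 would give
    -- `D + 3 ≤ 2 + degree G y ≤ 2 + D`.
    big+twos≤degree : count big + twos G y ≤ degree G y
    big+twos≤degree = ≤-trans (≤-reflexive (sym (sumFin-+ (λ w → [ big w ]) _))) (sumFin-mono pointwise)
      where
      exclusive : ∀ {a b c} → (T a → T c) → (T b → T c) → (T a → ¬ T b) → [ a ] + [ b ] ≤ [ c ]
      exclusive {false} {b}         _ g _ = []-mono g
      exclusive {true}  {false}     f _ _ = []-mono {true} f
      exclusive {true}  {true}      _ _ h with () ← h tt tt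
      pointwise : ∀ w → [ big w ] + [ adj G y w ∧ does (degree G w ≟ℕ 2) ] ≤ [ adj G y w ]
      pointwise w = exclusive {big w} {adj G y w ∧ does (degree G w ≟ℕ 2)}
        (λ b → isolate⊆ x G (proj₁ (T-∧⁻ {adj K y w} b)))
        (λ t → proj₁ (T-∧⁻ {adj G y w} t))
        λ b t → <⇒≱ (s≤s (bounded y)) (+-cancelˡ-≤ 2 _ _ (≤-trans (≤-reflexive (eq D))
          (subst (λ d → D + 3 ≤ d + degree G y)
            (does⁻ (degree G w ≟ℕ 2) (proj₂ (T-∧⁻ {adj G y w} t)))
            (does⁻ (D + 3 ≤? _) (proj₂ (T-∧⁻ {adj K y w} b))))))
        where
        eq : ∀ D → 2 + suc D ≡ D + 3
        eq = solve-∀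

    -- At least `D + 2 - degree G z` colours are missing at `z`, and they require as many neighbours
    -- of `y` that do not have degree 2.
    degree-sum : D + 2 + twos G y ≤ degree G y + degree G z
    degree-sum = cancel-≤ (count (unseen χ z) + degree K z + count big)
      (+-mono-≤ (+-mono-≤ (colours≤unseen+degree χ z) (degK xz)) (+-mono-≤ unseen≤big big+twos≤degree))
      (eq₁ D (twos G y) (count (unseen χ z)) (degree K z) (count big))
      (eq₂ (count (unseen χ z)) (degree K z) (degree G z) (count big) (degree G y))
      where
      eq₁ : ∀ D t u d b → D + 2 + t + (u + d + b) ≡ suc D + suc d + (u + (b + t))
      eq₁ = solve-∀
      eq₂ : ∀ u d dz b dy → u + d + dz + (b + dy) ≡ dy + dz + (u + d + b)
      eq₂ = solve-∀

  -- Colouring the two edges at the deleted vertex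

  module Colour (cover : ∀ w → Adj G x w → w ≡ y ⊎ w ≡ z) where

    -- Tries `a` on `xy` and `c` on `xz`. Only an alternating walk with fewer than `n` edges can
    -- prevent this, so the search is finite.
    extend-or-walk : (χ : EdgeColouring K (suc D)) → Acyclic χ → ∀ a c → ¬ Sees χ y a → ¬ Sees χ z c → a ≢ c →
                     (∃ λ l → Alt χ l a c z y) ⊎ AcyclicChromaticIndex≤ G (suc D)
    extend-or-walk χ χ-acyclic a c y∌a z∌c a≢c with any? {n} (λ l → alt? χ (toℕ l) a c z y)
    ... | yes (l , walk) = inj₁ (toℕ l , walk)
    ... | no no-walk     = inj₂ (extend , extend-acyclic χ-acyclic g-inj g-free no-alt)
      where
      g : Fin n → Fin (suc D)
      g v = if does (v ≟ y) then a else c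
      gy : g y ≡ a
      gy with y ≟ y
      ... | yes _  = refl
      ... | no y≢y with () ← y≢y refl
      gz : g z ≡ c
      gz with z ≟ y
      ... | yes z≡y with () ← y≢z (sym z≡y)
      ... | no _    = refl
      open Extension {G = G} x χ g
      g-inj : ∀ {v w} → Adj G x v → Adj G x w → v ≢ w → g v ≢ g w
      g-inj {v} {w} xv xw v≢w e with cover v xv | cover w xw
      ... | inj₁ refl | inj₁ refl = v≢w refl
      ... | inj₁ refl | inj₂ refl = a≢c (trans (sym gy) (trans e gz))
      ... | inj₂ refl | inj₁ refl = a≢c (trans (sym gy) (trans (sym e) gz))
      ... | inj₂ refl | inj₂ refl = v≢w refl
      g-free : ∀ {v} → Adj G x v → ¬ Sees χ v (g v)
      g-free {v} xv h with cover v xv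
      ... | inj₁ refl = y∌a (subst (Sees χ y) gy h)
      ... | inj₂ refl = z∌c (subst (Sees χ z) gz h)
      no-zy : ∀ {l} → l < n → ¬ Alt χ l a c z y
      no-zy l<n walk = no-walk (fromℕ< l<n , subst (λ l → Alt χ l a c z y) (sym (toℕ-fromℕ< l<n)) walk)
      no-alt : ∀ {v w} → Adj G x v → Adj G x w → v ≢ w → ∀ {l} → l < n → ¬ Alt χ l (g w) (g v) v w
      no-alt {v} {w} xv xw v≢w {l} l<n walk with cover v xv | cover w xw
      ... | inj₁ refl | inj₁ refl = v≢w refl
      ... | inj₂ refl | inj₂ refl = v≢w refl
      ... | inj₂ refl | inj₁ refl = no-zy l<n (subst₂ (λ a c → Alt χ l a c z y) gy gz walk)
      ... | inj₁ refl | inj₂ refl =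
        no-zy l<n (Alt-reverse-unseen χ l y≢z z∌c (subst₂ (λ c a → Alt χ l c a y z) gz gy walk))

    extend-or-blocked : (χ : EdgeColouring K (suc D)) → Acyclic χ → Blocked χ y z ⊎ AcyclicChromaticIndex≤ G (suc D)
    extend-or-blocked χ χ-acyclic = ∀-⊎ λ a → ∀-⊎ λ c → decide a c
      where
      decide : ∀ a c → (¬ Sees χ y a → ¬ Sees χ z c → a ≢ c → ∃ λ l → Alt χ l a c z y) ⊎ AcyclicChromaticIndex≤ G (suc D)
      decide a c with sees? χ y a | sees? χ z c | a ≟ c
      ... | yes s  | _      | _       = inj₁ λ y∌a _ _ → contradiction s y∌a
      ... | no _   | yes s  | _       = inj₁ λ _ z∌c _ → contradiction s z∌c
      ... | no _   | no _   | yes a≡c = inj₁ λ _ _ a≢c → contradiction a≡c a≢c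
      ... | no y∌a | no z∌c | no a≢c  with extend-or-walk χ χ-acyclic a c y∌a z∌c a≢c
      ...   | inj₁ walk = inj₁ λ _ _ _ → walk
      ...   | inj₂ col  = inj₂ col

    -- Exchanging two colours when D is at most 3

    module Cubic (D≤3 : D ≤ 3) (χ : EdgeColouring K (suc D)) (χ-acyclic : Acyclic χ) (blocked : Blocked χ y z) where
      open Degrees χ χ-acyclic blocked

      -- Otherwise `w` sees `c`, `c′` and the two or more colours missing at `y`, which makes four
      -- colours at a vertex of degree at most 3.
      misses : ∀ {c c′ w} → ¬ Sees χ z c → ¬ Sees χ z c′ → c′ ≢ c → Adj K y w → col χ y w ≡ c → ¬ Sees χ w c′
      misses {c} {c′} {w} z∌c z∌c′ c′≢c yw yw-c w∋c′ = <⇒≱ ≤-refl (begin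
        4                              ≤⟨ s≤s (s≤s (unseen≥2 χ xy)) ⟩
        2 + count (unseen χ y)         ≤⟨ s≤s (count-mono-< ⊆′ c y∌c (∖⁺ (seen χ w) (does⁺ (sees? χ w c) w∋c) (c′≢c ∘ sym))) ⟩
        suc (count (seen χ w ∖ c′))    ≤⟨ count-∖< (seen χ w) (does⁺ (sees? χ w c′) w∋c′) ⟩
        count (seen χ w)               ≤⟨ count-seen≤degree χ w ⟩
        degree K w                     ≤⟨ degree-isolate x G w ⟩
        degree G w                     ≤⟨ bounded w ⟩
        D                              ≤⟨ D≤3 ⟩
        3                              ∎)
        where
        open ≤-Reasoning
        w∋c : Sees χ w c
        w∋c = y , Adj-sym K yw , trans (sym (colSym χ y w yw)) yw-c
        y∌c : ¬ T (unseen χ y c)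
        y∌c t = does⁻ (¬? (sees? χ y c)) t (w , yw , yw-c)
        ⊆′ : ∀ a → T (unseen χ y a) → T ((seen χ w ∖ c′) a)
        ⊆′ a y∌a = ∖⁺ (seen χ w) (unseen⊆seen z∌c yw yw-c a y∌a)
          (unseen-distinct (does⁻ (¬? (sees? χ y a)) y∌a) z∌c′)

      module Swap {c₁ c₂ a} (z∌c₁ : ¬ Sees χ z c₁) (z∌c₂ : ¬ Sees χ z c₂) (c₂≢c₁ : c₂ ≢ c₁) (y∌a : ¬ Sees χ y a)
                  {y₁ y₂} (yy₁ : Adj K y y₁) (e₁ : col χ y y₁ ≡ c₁) (yy₂ : Adj K y y₂) (e₂ : col χ y y₂ ≡ c₂) where

        y₁≢y₂ : y₁ ≢ y₂
        y₁≢y₂ refl = c₂≢c₁ (trans (sym e₂) e₁)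
        coverY : ∀ w → Adj K y w → w ≡ y₁ ⊎ w ≡ y₂
        -- Having lost `x`, the vertex `y` has degree at most 2 in `K`.
        coverY = count≤2-cover (adj K y) (s≤s⁻¹ (≤-trans (degK xy) (≤-trans (bounded y) D≤3))) yy₁ yy₂ y₁≢y₂
        -- The colours of `yy₁` and `yy₂` exchanged: `y` is deleted from `K` and then put back with
        -- them.
        g : Fin n → Fin (suc D)
        g v = if does (v ≟ y₁) then c₂ else c₁
        gy₁ : g y₁ ≡ c₂
        gy₁ with y₁ ≟ y₁
        ... | yes _ = refl
        ... | no ≢  with () ← ≢ refl
        gy₂ : g y₂ ≡ c₁
        gy₂ with y₂ ≟ y₁
        ... | yes e with () ← y₁≢y₂ (sym e)
        ... | no _  = refl
        χ₀ : EdgeColouring (isolate y K) (suc D)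
        χ₀ = restrict y χ
        open Extension {G = K} y χ₀ g
        restrict-sees : ∀ {v c} → Sees χ₀ v c → Sees χ v c
        restrict-sees (w , vw , e) = w , isolate⊆ y K vw , e
        g-inj : ∀ {v w} → Adj K y v → Adj K y w → v ≢ w → g v ≢ g w
        g-inj {v} {w} yv yw v≢w e with coverY v yv | coverY w yw
        ... | inj₁ refl | inj₁ refl = v≢w refl
        ... | inj₁ refl | inj₂ refl = c₂≢c₁ (trans (sym gy₁) (trans e gy₂))
        ... | inj₂ refl | inj₁ refl = c₂≢c₁ (trans (sym gy₁) (trans (sym e) gy₂))
        ... | inj₂ refl | inj₂ refl = v≢w refl
        g-free : ∀ {v} → Adj K y v → ¬ Sees χ₀ v (g v)
        g-free {v} yv h with coverY v yv
        ... | inj₁ refl = misses z∌c₁ z∌c₂ c₂≢c₁ yy₁ e₁ (restrict-sees (subst (Sees χ₀ v) gy₁ h))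
        ... | inj₂ refl = misses z∌c₂ z∌c₁ (c₂≢c₁ ∘ sym) yy₂ e₂ (restrict-sees (subst (Sees χ₀ v) gy₂ h))
        -- The only edge at v coloured like yv is yv itself, which is deleted.
        loses : ∀ {v} → Adj K y v → ¬ Sees χ₀ v (col χ y v)
        loses {v} yv (w , vw , e) = let _ , w≢y , vw′ = isolate⁻ y K vw in
          proj₁ χ-acyclic v w y vw′ (Adj-sym K yv) w≢y (trans e (colSym χ y v yv))
        g-other : ∀ {v w} → Adj K y v → Adj K y w → v ≢ w → g w ≡ col χ y v
        g-other {v} {w} yv yw v≢w with coverY v yv | coverY w yw
        ... | inj₁ refl | inj₁ refl = contradiction refl v≢w
        ... | inj₁ refl | inj₂ refl = trans gy₂ (sym e₁)
        ... | inj₂ refl | inj₁ refl = trans gy₁ (sym e₂)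
        ... | inj₂ refl | inj₂ refl = contradiction refl v≢w
        -- The walk would leave `v` with the old colour of `yv`, which `v` no longer sees once `y`
        -- is deleted.
        no-alt : ∀ {v w} → Adj K y v → Adj K y w → v ≢ w → ∀ {l} → l < n → ¬ Alt χ₀ l (g w) (g v) v w
        no-alt {v} {w} yv yw v≢w {l} _ walk =
          loses yv (subst (Sees χ₀ v) (g-other yv yw v≢w) (Alt-sees χ₀ {l} v≢w walk))
        ψ : EdgeColouring K (suc D)
        ψ = extend
        ψ-acyclic : Acyclic ψ
        ψ-acyclic = extend-acyclic (restrict-acyclic y χ χ-acyclic) g-inj g-free no-alt
        c₁-seen : Sees χ y c₁
        c₁-seen = y₁ , yy₁ , e₁
        y∌ψa : ¬ Sees ψ y a
        y∌ψa (w , yw , e) with coverY w yw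
        ... | inj₁ refl = y∌a (y₂ , yy₂ , trans e₂ (trans (sym gy₁) (trans (sym (extCol-x y₁)) e)))
        ... | inj₂ refl = y∌a (y₁ , yy₁ , trans e₁ (trans (sym gy₂) (trans (sym (extCol-x y₂)) e)))
        -- `z` misses both colours used at `y` towards `y₁` and `y₂`. Hence the exchange leaves the
        -- edges at `z` unchanged.
        z≁y : ¬ Adj K z y
        z≁y zy with coverY z (Adj-sym K zy)
        ... | inj₁ refl = z∌c₁ (y , zy , trans (colSym χ z y zy) e₁)
        ... | inj₂ refl = z∌c₂ (y , zy , trans (colSym χ z y zy) e₂)
        z∌ψc₁ : ¬ Sees ψ z c₁
        z∌ψc₁ (w , zw , e) = z∌c₁ (w , zw , trans (sym (extCol-off (y≢z ∘ sym) (λ { refl → z≁y zw }))) e)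
        agree : ∀ {u v} → Adj (isolate y K) u v → extCol u v ≡ col χ u v
        agree {u} {v} uv = let u≢y , v≢y , _ = isolate⁻ y K {u} {v} uv in extCol-off u≢y v≢y
        -- If `ψ` did not extend either, the alternating walks from `z` would reach `y` through `y₁`
        -- in `χ` and through `y₂` in `ψ`. Cut before `y`, both are maximal walks of the same
        -- colouring `χ₀` with the same start, so their ends coincide.
        result : AcyclicChromaticIndex≤ G (suc D)
        result with extend-or-walk ψ ψ-acyclic a c₁ y∌ψa z∌ψc₁ (λ { refl → y∌a c₁-seen })
                  | blocked a c₁ y∌a z∌c₁ (λ { refl → y∌a c₁-seen })
        ... | inj₂ coloured    | _         = coloured
        ... | inj₁ (l′ , walk′) | l , walk = contradiction
          (MaxAlt-unique χ₀ (proj₁ (restrict-acyclic y χ χ-acyclic))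
            (truncate y χ₀ χ (proj₁ χ-acyclic) (λ _ → refl) y∌a yy₁ e₁ l (inj₁ refl) (inj₂ refl) (y≢z ∘ sym) walk)
            (truncate y χ₀ ψ (proj₁ ψ-acyclic) agree y∌ψa yy₂ (trans (extCol-x y₂) gy₂) l′ (inj₁ refl) (inj₂ refl) (y≢z ∘ sym) walk′))
          y₁≢y₂

      cubic : AcyclicChromaticIndex≤ G (suc D)
      cubic =
        let c₁ , z∌c₁ = count-witness (unseen χ z) (≤-trans (s≤s z≤n) (unseen≥2 χ xz))
            c₂ , z∌c₂ , c₂≢c₁ = count-witness-≢ (unseen χ z) (unseen≥2 χ xz) c₁
            a , y∌a = count-witness (unseen χ y) (≤-trans (s≤s z≤n) (unseen≥2 χ xy))
            z∌c₁′ = does⁻ (¬? (sees? χ z c₁)) z∌c₁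
            z∌c₂′ = does⁻ (¬? (sees? χ z c₂)) z∌c₂
            y₁ , yy₁ , e₁ = z∌⇒y∋ z∌c₁′
            y₂ , yy₂ , e₂ = z∌⇒y∋ z∌c₂′
        in Swap.result z∌c₁′ z∌c₂′ c₂≢c₁ (does⁻ (¬? (sees? χ y a)) y∌a) yy₁ e₁ yy₂ e₂

-- Reducible configurations and discharging

record Irreducible {n} (G : Graph n) (D : ℕ) (x : Fin n) : Set where
  field
    {y z}  : Fin n
    xy     : Adj G x y
    xz     : Adj G x z
    y≢z    : y ≢ z
    cover  : ∀ w → Adj G x w → w ≡ y ⊎ w ≡ z
    4≤D    : 4 ≤ D
    sum-y  : D + 2 + twos G y ≤ degree G y + degree G z
    sum-z  : D + 2 + twos G z ≤ degree G z + degree G y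

module Reductions {n D} (G : Graph n) (bounded : ∀ v → degree G v ≤ D) where

  -- Any colour missing at the only neighbour of `x` will do, and no cycle passes through `x`.
  colour-leaf : ∀ x → degree G x ≡ 1 → AcyclicChromaticIndex≤ (isolate x G) (suc D) → AcyclicChromaticIndex≤ G (suc D)
  colour-leaf x d≡1 (χ , χ-acyclic)
    with y , xy ← count-witness (adj G x) (≤-reflexive (sym d≡1))
    with c , y∌c ← count-witness (unseen χ y) (≤-trans (s≤s z≤n) (two-colours-unseen G bounded χ xy))
    = Extension.extend x χ (λ _ → c) , Extension.extend-acyclic x χ (λ _ → c) χ-acyclic
        (λ xv xw v≢w → ⊥-elim (v≢w (unique xv xw)))
        (λ xv v∋c → does⁻ (¬? (sees? χ y c)) y∌c (subst (λ v → Sees χ v c) (unique xv xy) v∋c))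
        (λ xv xw v≢w → ⊥-elim (v≢w (unique xv xw)))
    where
    unique : ∀ {v w} → Adj G x v → Adj G x w → v ≡ w
    unique {v} {w} xv xw with v ≟ w
    ... | yes v≡w = v≡w
    ... | no v≢w  = contradiction (≤-trans (count≥2 (adj G x) xv xw v≢w) (≤-reflexive d≡1)) (<⇒≱ ≤-refl)

  irreducible-or-colour : ∀ x → degree G x ≡ 2 → AcyclicChromaticIndex≤ (isolate x G) (suc D) →
                    Irreducible G D x ⊎ AcyclicChromaticIndex≤ G (suc D)
  irreducible-or-colour x d≡2 (χ , χ-acyclic) = helper (count-witness (adj G x) (≤-trans (s≤s z≤n) (≤-reflexive (sym d≡2))))
    where
    module _ {y z} (xy : Adj G x y) (xz : Adj G x z) (z≢y : z ≢ y) where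
      y≢z : y ≢ z
      y≢z = z≢y ∘ sym
      cover : ∀ w → Adj G x w → w ≡ y ⊎ w ≡ z
      cover = count≤2-cover (adj G x) (≤-reflexive d≡2) xy xz y≢z
      module TV = TwoVertex G bounded xy xz y≢z
      decide : Irreducible G D x ⊎ AcyclicChromaticIndex≤ G (suc D)
      decide with TV.Colour.extend-or-blocked cover χ χ-acyclic | D ≤? 3
      ... | inj₂ coloured | _       = inj₂ coloured
      ... | inj₁ blocked  | yes D≤3 = inj₂ (TV.Colour.Cubic.cubic cover D≤3 χ χ-acyclic blocked)
      ... | inj₁ blocked  | no D≰3  = inj₁ record
        { xy = xy ; xz = xz ; y≢z = y≢z ; cover = cover ; 4≤D = ≰⇒> D≰3
        ; sum-y = TV.Degrees.degree-sum χ χ-acyclic blocked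
        -- Reversing the walks makes the obstruction symmetric, so the count can be repeated with
        -- `y` and `z` exchanged.
        ; sum-z = TwoVertex.Degrees.degree-sum G bounded xz xy z≢y χ χ-acyclic (Blocked-sym χ y≢z blocked) }
    helper : (∃ λ y → Adj G x y) → Irreducible G D x ⊎ AcyclicChromaticIndex≤ G (suc D)
    helper (y , xy) = let z , xz , z≢y = count-witness-≢ (adj G x) (≤-reflexive (sym d≡2)) y in decide xy xz z≢y

nonIsolated : ∀ {n} → Graph n → Fin n → Bool
nonIsolated G v = does (1 ≤? degree G v)

-- The subgraph that will violate the density bound. Isolated vertices, including those deleted in
-- the induction, carry no charge and are left out.
nonIsolatedSubgraph : ∀ {n} (G : Graph n) → Subgraph G
nonIsolatedSubgraph G = record
  { vset = nonIsolated G ; eset = adj G ; esym = adj-sym G ; e⊆adj = λ _ _ uv → uv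
  ; e⊆vset = λ u v uv → T-∧⁺ (does⁺ (1 ≤? degree G u) (count-pos (adj G u) v uv))
                             (does⁺ (1 ≤? degree G v) (count-pos (adj G v) u (Adj-sym G uv))) }

-- `numEdges` counts an edge at its increasing orientation, so each ordered pair is covered by
-- `E u v` or `E v u`.
handshake : ∀ {n} (G : Graph n) → let e = numEdges (nonIsolatedSubgraph G) in sumFin (degree G) ≤ e + e
handshake {n} G = begin
  sumFin (λ u → sumFin (λ v → [ adj G u v ]))            ≤⟨ sumFin-mono (λ u → sumFin-mono (λ v → oriented u v)) ⟩
  sumFin (λ u → sumFin (λ v → E u v + E v u))            ≡⟨ sumFin-cong (λ u → sumFin-+ (E u) (λ v → E v u)) ⟩
  sumFin (λ u → sumFin (E u) + sumFin (λ v → E v u))     ≡⟨ sumFin-+ (λ u → sumFin (E u)) (λ u → sumFin (λ v → E v u)) ⟩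
  e + sumFin (λ u → sumFin (λ v → E v u))                ≡⟨ cong (e +_) (sumFin-swap (λ u v → E v u)) ⟩
  e + e                                                  ∎
  where
  open ≤-Reasoning
  e : ℕ
  e = numEdges (nonIsolatedSubgraph G)
  E : Fin n → Fin n → ℕ
  E u v = [ ⌊ toℕ u <? toℕ v ⌋ ∧ adj G u v ]
  E-< : ∀ {u v} → toℕ u < toℕ v → [ adj G u v ] ≤ E u v
  E-< {u} {v} u<v = []-mono (λ uv → T-∧⁺ (fromWitness {a? = toℕ u <? toℕ v} u<v) uv)
  oriented : ∀ u v → [ adj G u v ] ≤ E u v + E v u
  oriented u v with <-cmp (toℕ u) (toℕ v)
  ... | tri< u<v _ _ = ≤-trans (E-< u<v) (m≤m+n (E u v) (E v u))
  ... | tri≈ _ u≡v _ rewrite toℕ-injective u≡v | irrefl G v = z≤n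
  ... | tri> _ _ v<u rewrite adj-sym G u v = ≤-trans (E-< v<u) (m≤n+m (E v u) _)

module Discharging {n D} (G : Graph n) (bounded : ∀ v → degree G v ≤ D)
                   (no-leaf : ∀ v → degree G v ≢ 1) (irreducible : ∀ v → degree G v ≡ 2 → Irreducible G D v) where

  twoNeighbour : Fin n → Fin n → Bool
  twoNeighbour v w = adj G v w ∧ does (degree G w ≟ℕ 2)

  -- The charge that `v` sends to each of its neighbours of degree 2.
  share : Fin n → ℕ
  share v = amount (degree G v ≤? 3) (twos G v ≤? 1)
    where
    amount : ∀ {P Q : Set} → Dec P → Dec Q → ℕ
    amount (yes _) _       = 0
    amount (no _)  (yes _) = 2
    amount (no _)  (no _)  = 1

  share-small : ∀ {v} → degree G v ≤ 3 → share v ≡ 0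
  share-small {v} d≤3 with degree G v ≤? 3
  ... | yes _  = refl
  ... | no d≰3 = contradiction d≤3 d≰3

  share-positive : ∀ {v} → ¬ degree G v ≤ 3 → 1 ≤ share v
  share-positive {v} d≰3 with degree G v ≤? 3 | twos G v ≤? 1
  ... | yes d≤3 | _     = contradiction d≤3 d≰3
  ... | no _    | yes _ = s≤s z≤n
  ... | no _    | no _  = s≤s z≤n

  share-single : ∀ {v} → ¬ degree G v ≤ 3 → twos G v ≤ 1 → 2 ≤ share v
  share-single {v} d≰3 t≤1 with degree G v ≤? 3 | twos G v ≤? 1
  ... | yes d≤3 | _      = contradiction d≤3 d≰3
  ... | no _    | yes _  = ≤-refl
  ... | no _    | no t≰1 = contradiction t≤1 t≰1

  twos-pos : ∀ {v w} → Adj G v w → degree G w ≡ 2 → 1 ≤ twos G v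
  twos-pos {v} {w} vw d≡2 = count-pos (twoNeighbour v) w (T-∧⁺ vw (does⁺ (degree G w ≟ℕ 2) d≡2))

  -- From `sum-y` and `1 ≤ twos G y` follows `D ≤ degree G z`, so `z` does send charge. From `sum-z`
  -- and `degree G z ≤ D` follows `twos G z ≤ 1`, so it sends 2.
  share-opposite : ∀ {y z} → 4 ≤ D → 1 ≤ twos G y → D + 2 + twos G y ≤ degree G y + degree G z →
                   D + 2 + twos G z ≤ degree G z + degree G y → degree G y ≤ 3 → 2 ≤ share z
  share-opposite {y} {z} 4≤D 1≤t sum-y sum-z d≤3 = share-single (<⇒≱ (≤-trans 4≤D D≤dz))
    (cancel-≤ (2 + (D + (degree G z + degree G y))) (+-mono-≤ (+-mono-≤ sum-z (bounded z)) d≤3)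
      (eq₃ D (twos G z) (degree G z) (degree G y)) (eq₄ (degree G z) (degree G y) D))
    where
    D≤dz : D ≤ degree G z
    D≤dz = cancel-≤ (3 + (twos G y + degree G y)) (+-mono-≤ (+-mono-≤ sum-y 1≤t) d≤3)
      (eq₁ D (twos G y) (degree G y)) (eq₂ (degree G y) (degree G z) (twos G y))
      where
      eq₁ : ∀ D t dy → D + (3 + (t + dy)) ≡ D + 2 + t + 1 + dy
      eq₁ = solve-∀
      eq₂ : ∀ dy dz t → dy + dz + t + 3 ≡ dz + (3 + (t + dy))
      eq₂ = solve-∀
    eq₃ : ∀ D t dz dy → t + (2 + (D + (dz + dy))) ≡ D + 2 + t + dz + dy
    eq₃ = solve-∀
    eq₄ : ∀ dz dy D → dz + dy + D + 3 ≡ 1 + (2 + (D + (dz + dy)))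
    eq₄ = solve-∀

  flow : Fin n → Fin n → ℕ
  flow v w = [ twoNeighbour v w ] * share v

  outflow : ∀ v → sumFin (flow v) ≡ twos G v * share v
  outflow v = sumFin-*ʳ (λ w → [ twoNeighbour v w ]) (share v)

  flow-two : ∀ {v w} → Adj G v w → degree G w ≡ 2 → share v ≤ flow v w
  flow-two {v} {w} vw d≡2 = ≤-trans (≤-reflexive (sym (*-identityˡ (share v))))
    (*-monoˡ-≤ (share v) ([]-mono {true} {twoNeighbour v w} (λ _ → T-∧⁺ vw (does⁺ (degree G w ≟ℕ 2) d≡2))))

  -- If one neighbour has degree at most 3, the other sends 2; if neither has, each sends at least
  -- 1.
  inflow : ∀ {x} → degree G x ≡ 2 → 2 ≤ sumFin (λ v → flow v x)
  inflow {x} d≡2 = ≤-trans (shares (degree G y ≤? 3) (degree G z ≤? 3)) (≤-trans (+-mono-≤ (flow-two yx d≡2) (flow-two zx d≡2))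
                                           (two-terms≤sumFin (λ v → flow v x) y≢z))
    where
    open Irreducible (irreducible x d≡2)
    yx : Adj G y x
    yx = Adj-sym G xy
    zx : Adj G z x
    zx = Adj-sym G xz
    shares : Dec (degree G y ≤ 3) → Dec (degree G z ≤ 3) → 2 ≤ share y + share z
    shares (yes dy≤3) _ = ≤-trans (share-opposite 4≤D (twos-pos yx d≡2) sum-y sum-z dy≤3) (m≤n+m (share z) (share y))
    shares (no _) (yes dz≤3) = ≤-trans (share-opposite 4≤D (twos-pos zx d≡2) sum-z sum-y dz≤3) (m≤m+n (share y) (share z))
    shares (no dy≰3) (no dz≰3) = +-mono-≤ (share-positive dy≰3) (share-positive dz≰3)

  -- Take a neighbour of `v` of degree 2: its other neighbour has degree at most `D`, which cancels
  -- against the `D` in the degree inequality.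
  twos+2≤degree : ∀ {v} → 1 ≤ twos G v → twos G v + 2 ≤ degree G v
  twos+2≤degree {v} 1≤t with count-witness (twoNeighbour v) 1≤t
  ... | x , vx∧d≡2 with T-∧⁻ {adj G v x} vx∧d≡2
  ... | vx , d≡2 = bound (irreducible x (does⁻ (degree G x ≟ℕ 2) d≡2))
    where
    from-sum : ∀ {z} → D + 2 + twos G v ≤ degree G v + degree G z → twos G v + 2 ≤ degree G v
    from-sum {z} h = cancel-≤ (D + degree G z) (+-mono-≤ h (bounded z))
      (eq₁ (twos G v) D (degree G z)) (eq₂ (degree G v) (degree G z) D)
      where
      eq₁ : ∀ t D dz → t + 2 + (D + dz) ≡ D + 2 + t + dz
      eq₁ = solve-∀
      eq₂ : ∀ dv dz D → dv + dz + D ≡ dv + (D + dz)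
      eq₂ = solve-∀
    bound : Irreducible G D x → twos G v + 2 ≤ degree G v
    bound L with Irreducible.cover L v (Adj-sym G vx)
    ... | inj₁ refl = from-sum (Irreducible.sum-y L)
    ... | inj₂ refl = from-sum (Irreducible.sum-z L)

  -- Up to degree 3 nothing is sent. From degree 4 on, a single receiver costs 2 out of at least 8,
  -- and `t` receivers cost `t`, where `6 + t = (t + 2) + 4` is at most twice the degree.
  outflow-bound : ∀ {v} → 3 ≤ degree G v → 6 + twos G v * share v ≤ degree G v * 2
  outflow-bound {v} 3≤d with degree G v ≤? 3 | twos G v ≤? 1
  ... | yes _  | _       rewrite *-zeroʳ (twos G v) = *-monoˡ-≤ 2 3≤d
  ... | no d≰3 | yes t≤1 = ≤-trans (+-monoʳ-≤ 6 (*-monoˡ-≤ 2 t≤1)) (*-monoˡ-≤ 2 (≰⇒> d≰3))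
  ... | no d≰3 | no t≰1  = cancel-≤ 0
    (+-mono-≤ (twos+2≤degree (≤-trans (s≤s z≤n) (≰⇒> t≰1))) (≰⇒> d≰3)) (eq₁ (twos G v)) (eq₂ (degree G v))
    where
    eq₁ : ∀ t → 6 + t * 1 + 0 ≡ t + 2 + 4
    eq₁ = solve-∀
    eq₂ : ∀ d → d + d ≡ d * 2 + 0
    eq₂ = solve-∀

  -- The final charge is at least 6 unless `v` is isolated; the outflow stands on the left to avoid
  -- subtraction.
  balance : ∀ v → [ nonIsolated G v ] * 6 + sumFin (flow v) ≤ degree G v * 2 + sumFin (λ w → flow w v)
  balance v rewrite outflow v with 3 ≤? degree G v
  ... | yes 3≤d = ≤-trans (+-monoˡ-≤ (twos G v * share v) (*-monoˡ-≤ 6 ([]-mono {nonIsolated G v} {true} _)))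
                    (≤-trans (outflow-bound 3≤d) (m≤m+n _ _))
  ... | no 3≰d rewrite share-small {v} (<⇒≤ (≰⇒> 3≰d)) | *-zeroʳ (twos G v) = small (degree G v) refl (≰⇒> 3≰d)
    where
    small : ∀ d → degree G v ≡ d → d < 3 →
            [ nonIsolated G v ] * 6 + 0 ≤ degree G v * 2 + sumFin (λ w → flow w v)
    small 0 d≡0 _ = ≤-trans (≤-reflexive (trans (+-identityʳ _) (cong (λ d → [ does (1 ≤? d) ] * 6) d≡0))) z≤n
    small 1 d≡1 _ = contradiction d≡1 (no-leaf v)
    small 2 d≡2 _ = ≤-trans (≤-reflexive (trans (+-identityʳ _) (cong (λ d → [ does (1 ≤? d) ] * 6) d≡2)))
      (+-mono-≤ (≤-reflexive (cong (_* 2) (sym d≡2))) (inflow d≡2))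
    small (suc (suc (suc _))) _ (s≤s (s≤s (s≤s ())))

  -- Summed over all vertices, inflow and outflow agree and cancel.
  six-per-vertex : count (nonIsolated G) * 6 ≤ sumFin (degree G) * 2
  six-per-vertex = +-cancelʳ-≤ (sumFin (λ v → sumFin (flow v))) _ _ (begin
    count (nonIsolated G) * 6 + sumFin (λ v → sumFin (flow v))
      ≡⟨ cong (_+ sumFin (λ v → sumFin (flow v))) (sumFin-*ʳ (λ v → [ nonIsolated G v ]) 6) ⟨
    sumFin (λ v → [ nonIsolated G v ] * 6) + sumFin (λ v → sumFin (flow v))
      ≡⟨ sumFin-+ (λ v → [ nonIsolated G v ] * 6) (λ v → sumFin (flow v)) ⟨
    sumFin (λ v → [ nonIsolated G v ] * 6 + sumFin (flow v))
      ≤⟨ sumFin-mono balance ⟩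
    sumFin (λ v → degree G v * 2 + sumFin (λ w → flow w v))
      ≡⟨ sumFin-+ (λ v → degree G v * 2) (λ v → sumFin (λ w → flow w v)) ⟩
    sumFin (λ v → degree G v * 2) + sumFin (λ v → sumFin (λ w → flow w v))
      ≡⟨ cong₂ _+_ (sumFin-*ʳ (degree G) 2) (sumFin-swap (λ v w → flow w v)) ⟩
    sumFin (degree G) * 2 + sumFin (λ v → sumFin (flow v)) ∎)
    where open ≤-Reasoning

  -- With the handshake bound, `6|V|` is at most `4|E|` on the non-isolated part, which `v` shows to
  -- be nonempty.
  dense : ∀ {v} → 1 ≤ degree G v → ¬ madLessThan3 G
  dense {v} 1≤d mad = <⇒≱ (mad H (count-pos (nonIsolated G) v (does⁺ (1 ≤? degree G v) 1≤d)))
    (*-cancelʳ-≤ (3 * numVertices H) (2 * numEdges H) 2 (begin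
      3 * numVertices H * 2          ≡⟨ eq₁ (numVertices H) ⟩
      numVertices H * 6              ≤⟨ six-per-vertex ⟩
      sumFin (degree G) * 2          ≤⟨ *-monoˡ-≤ 2 (handshake G) ⟩
      (numEdges H + numEdges H) * 2  ≡⟨ eq₂ (numEdges H) ⟩
      2 * numEdges H * 2             ∎))
    where
    open ≤-Reasoning
    H : Subgraph G
    H = nonIsolatedSubgraph G
    eq₁ : ∀ v → 3 * v * 2 ≡ v * 6
    eq₁ = solve-∀
    eq₂ : ∀ e → (e + e) * 2 ≡ 2 * e * 2
    eq₂ = solve-∀

-- The induction on the number of edges

isolate-mad : ∀ {n} (x : Fin n) (G : Graph n) → madLessThan3 G → madLessThan3 (isolate x G)
isolate-mad x G mad H = mad record
  { vset = vset H ; eset = eset H ; esym = esym H ; e⊆adj = λ u v uv → isolate⊆ x G (e⊆adj H u v uv) ; e⊆vset = e⊆vset H }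

degree≤maxDegree : ∀ {n} (G : Graph n) v → degree G v ≤ maxDegree G
degree≤maxDegree G v = ≤-max (∈-map⁺ (degree G) (∈-allFin v))
  where
  ≤-max : ∀ {d ds} → d ∈ ds → d ≤ foldr _⊔_ 0 ds
  ≤-max (here refl) = m≤m⊔n _ _
  ≤-max (there d∈)  = ≤-trans (≤-max d∈) (m≤n⊔m _ _)

edgeless : ∀ {n k} (G : Graph n) → (∀ v → ¬ 1 ≤ degree G v) → AcyclicChromaticIndex≤ G (suc k)
edgeless G isolated =
  record { col = λ _ _ → zero ; colSym = λ _ _ _ → refl } ,
  (λ u v _ uv → ⊥-elim (isolated u (count-pos (adj G u) v uv))) ,
  λ C _ → isolated _ (count-pos (adj G _) _ (close C))

-- The bound `D` stays fixed while vertices are deleted, whereas the maximum degree could drop. The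
-- degree sum serves as the measure.
acyclic-colouring : ∀ {n D} (G : Graph n) → (∀ v → degree G v ≤ D) → madLessThan3 G →
                    Acc _<_ (sumFin (degree G)) → AcyclicChromaticIndex≤ G (suc D)
acyclic-colouring {n} {D} G bounded mad (acc rec) with any? (λ v → 1 ≤? degree G v)
... | no none         = edgeless G λ v 1≤d → none (v , 1≤d)
... | yes (v , 1≤deg) = conclude (∀-⊎ reduce)
  where
  smaller : ∀ x → 1 ≤ degree G x → AcyclicChromaticIndex≤ (isolate x G) (suc D)
  smaller x 1≤d = acyclic-colouring (isolate x G) (λ v → ≤-trans (degree-isolate x G v) (bounded v)) (isolate-mad x G mad)
    (rec (let y , xy = count-witness (adj G x) 1≤d in
      sumFin-mono-< (degree-isolate x G) y (degree-isolate-< x G (Adj-sym G xy))))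
  reduce : ∀ x → (degree G x ≢ 1 × (degree G x ≡ 2 → Irreducible G D x)) ⊎ AcyclicChromaticIndex≤ G (suc D)
  reduce x with degree G x ≟ℕ 1 | degree G x ≟ℕ 2
  ... | yes d≡1 | _       = inj₂ (Reductions.colour-leaf G bounded x d≡1 (smaller x (≤-reflexive (sym d≡1))))
  ... | no d≢1  | no d≢2  = inj₁ (d≢1 , λ d≡2 → contradiction d≡2 d≢2)
  ... | no d≢1  | yes d≡2 with Reductions.irreducible-or-colour G bounded x d≡2 (smaller x (≤-trans (s≤s z≤n) (≤-reflexive (sym d≡2))))
  ...   | inj₁ irr    = inj₁ (d≢1 , λ _ → irr)
  ...   | inj₂ coloured = inj₂ coloured
  conclude : (∀ x → degree G x ≢ 1 × (degree G x ≡ 2 → Irreducible G D x)) ⊎ AcyclicChromaticIndex≤ G (suc D) →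
             AcyclicChromaticIndex≤ G (suc D)
  conclude (inj₂ coloured) = coloured
  -- No vertex allowed a colouring, so all of them satisfy the hypotheses of the discharging
  -- argument.
  conclude (inj₁ sparse)   = ⊥-elim (Discharging.dense G bounded (proj₁ ∘ sparse) (proj₂ ∘ sparse) 1≤deg mad)

theorem2 : ∀ (n : ℕ) (G : Graph n) → madLessThan3 G →
    AcyclicChromaticIndex≤ G (suc (maxDegree G))
theorem2 n G mad = acyclic-colouring G (degree≤maxDegree G) mad (<-wellFounded _)
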